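{- For every $n\in\mathbb{N}$, let $M_n$ be the average resistance of all $n$-circuits. Then $$M_n\ge 1 .$$
   Context: $\mathbb{N}=\{1,2,3,\dots\}$. Circuits are defined recursively and represented by ordered pairs of multisets. The unit circuit $(\{\},\{\})$ is a single unit resistor; it is considered to be both a series and a parallel circuit. A (non-unit) series circuit is a pair $(\{\alpha_1,\dots,\alpha_m\},\{\})$ where $\{\alpha_1,\dots,\alpha_m\}$ is a finite multiset of $m\ge 2$ parallel circuits (the unit circuit being allowed). A (non-unit) parallel circuit is a pair $(\{\},\{\beta_1,\dots,\beta_m\})$ where $\{\beta_1,\dots,\beta_m\}$ is a finite multiset of $m\ge 2$ series circuits (the unit circuit being allowed). Two circuits are the same iff these representations are equal. An $n$-circuit is a circuit containing exactly $n$ unit resistors (the unit circuit contains one; otherwise add the numbers in the sub-circuits). The resistance $r$ is defined by $r=1$ for the unit circuit, $r=\sum_i r(\alpha_i)$ for a series circuit with sub-circuits $\alpha_i$, and $r=\left(\sum_i r(\beta_i)^{ -1}\right)^{ -1}$ for a parallel circuit with sub-circuits $\beta_i$. $\Gamma_n$ is the (finite) set of all $n$-circuits, $Q_n=|\Gamma_n|$, $R_n=\sum_{\gamma\in\Gamma_n} r(\gamma)$, and $M_n=R_n/Q_n$. -}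

module Defs where

open import Data.Integer using (+_)
open import Data.List using (List; []; _∷_; _++_; length; map; mapMaybe; foldr; replicate; deduplicate; cartesianProductWith)
open import Data.List.Membership.Propositional using (_∈_)
open import Data.List.Membership.Propositional.Properties using (∈-map⁺; ∈-++⁺ˡ; ∈-++⁺ʳ; ∈-cartesianProductWith⁺)
open import Data.List.Properties using (length-replicate)
open import Data.List.Relation.Binary.Permutation.Homogeneous using (Permutation; refl; prep; swap; trans)
open import Data.List.Relation.Binary.Pointwise using (Pointwise; []; _∷_)
open import Data.List.Relation.Unary.All as All using (All; []; _∷_)
open import Data.List.Relation.Unary.Any as Any using (Any; here; there; _─_; any?)
open import Data.List.Relation.Unary.Enumerates.Setoid using (IsEnumeration)
import Data.List.Relation.Unary.Enumerates.Setoid.Properties as Enumerates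
import Data.List.Relation.Unary.All.Properties as All
import Data.List.Relation.Unary.Unique.DecSetoid.Properties as Unique
open import Data.List.Relation.Unary.Unique.Setoid using (Unique)
open import Data.Maybe using (Maybe; just; nothing)
open import Data.Nat as ℕ using (ℕ; zero; suc; _≤_; z≤n; s≤s)
import Data.Nat.Properties as ℕ
open import Data.Product using (Σ-syntax; _×_; _,_; proj₁; proj₂)
open import Data.Rational as ℚ using (ℚ; 0ℚ; 1ℚ; 1/_; _+_; _*_; _/_)
import Data.Rational.Properties as ℚ
open import Data.Sum using (_⊎_; inj₁; inj₂)
open import Function using (_∘_; _on_)
open import Level using (0ℓ)
open import Relation.Binary using (Rel; Setoid; DecSetoid; IsEquivalence; Decidable)
import Relation.Binary.Construct.On as On
open import Relation.Binary.PropositionalEquality using (_≡_; cong; sym; subst) renaming (refl to ≡-refl)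
open import Relation.Nullary using (Dec; yes; no; contradiction)
open import Relation.Nullary.Decidable using (map′; _×-dec_; _⊎-dec_)

-- Hereditary pairs of finite multisets.  A multiset is represented by a list,
-- and lists are compared up to permutation by _≈_ below.

data Rep : Set where
  ⟨_∣_⟩ : (αs βs : List Rep) → Rep

data _≈_ : Rel Rep 0ℓ where
  ⟨_∣_⟩ : ∀ {αs αs′ βs βs′} → Permutation _≈_ αs αs′ → Permutation _≈_ βs βs′ →
          ⟨ αs ∣ βs ⟩ ≈ ⟨ αs′ ∣ βs′ ⟩

infix 4 _≈_

pattern unit = ⟨ [] ∣ [] ⟩

data IsSeries   : Rep → Set
data IsParallel : Rep → Set

data IsSeries where
  unitˢ  : IsSeries unit
  series : ∀ {αs} → 2 ≤ length αs → All IsParallel αs → IsSeries ⟨ αs ∣ [] ⟩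

data IsParallel where
  unitᵖ    : IsParallel unit
  parallel : ∀ {βs} → 2 ≤ length βs → All IsSeries βs → IsParallel ⟨ [] ∣ βs ⟩

IsCircuit : Rep → Set
IsCircuit c = IsSeries c ⊎ IsParallel c

-- At most one of the two summands in the last clause is nonzero on circuits.

size  : Rep → ℕ
sizes : List Rep → ℕ

size unit        = 1
size ⟨ αs ∣ βs ⟩ = sizes αs ℕ.+ sizes βs

sizes []       = 0
sizes (c ∷ cs) = size c ℕ.+ sizes cs

-- The last clause of r is a dummy value: no circuit has both components
-- nonempty.  It is positive so that r-pos holds for every Rep, which is what
-- justifies the inverses.

r         : Rep → ℚ
r-pos     : ∀ c → ℚ.Positive (r c)
r⁻¹       : Rep → ℚ
r⁻¹-pos   : ∀ c → ℚ.Positive (r⁻¹ c)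
Σr        : List Rep → ℚ
Σr-pos    : ∀ c cs → ℚ.Positive (Σr (c ∷ cs))
Σr⁻¹      : List Rep → ℚ
Σr⁻¹-pos  : ∀ c cs → ℚ.Positive (Σr⁻¹ (c ∷ cs))

r unit                      = 1ℚ
r ⟨ α ∷ αs ∣ [] ⟩           = Σr (α ∷ αs)
r ⟨ [] ∣ β ∷ βs ⟩           = 1/_ (Σr⁻¹ (β ∷ βs)) {{ℚ.pos⇒nonZero (Σr⁻¹ (β ∷ βs)) {{Σr⁻¹-pos β βs}}}}
r ⟨ _ ∷ _ ∣ _ ∷ _ ⟩         = 1ℚ

r⁻¹ c = 1/_ (r c) {{ℚ.pos⇒nonZero (r c) {{r-pos c}}}}

Σr []       = 0ℚ
Σr (c ∷ cs) = r c + Σr cs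

Σr⁻¹ []       = 0ℚ
Σr⁻¹ (c ∷ cs) = r⁻¹ c + Σr⁻¹ cs

r-pos unit                = _
r-pos ⟨ α ∷ αs ∣ [] ⟩     = Σr-pos α αs
r-pos ⟨ [] ∣ β ∷ βs ⟩     = ℚ.1/pos⇒pos (Σr⁻¹ (β ∷ βs)) {{Σr⁻¹-pos β βs}}
r-pos ⟨ _ ∷ _ ∣ _ ∷ _ ⟩   = _

r⁻¹-pos c = ℚ.1/pos⇒pos (r c) {{r-pos c}}

Σr-pos c []        = subst ℚ.Positive (sym (ℚ.+-identityʳ (r c))) (r-pos c)
Σr-pos c (c′ ∷ cs) = ℚ.pos+pos⇒pos (r c) {{r-pos c}} (Σr (c′ ∷ cs)) {{Σr-pos c′ cs}}

Σr⁻¹-pos c []        = subst ℚ.Positive (sym (ℚ.+-identityʳ (r⁻¹ c))) (r⁻¹-pos c)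
Σr⁻¹-pos c (c′ ∷ cs) = ℚ.pos+pos⇒pos (r⁻¹ c) {{r⁻¹-pos c}} (Σr⁻¹ (c′ ∷ cs)) {{Σr⁻¹-pos c′ cs}}

-- _≈_ is a decidable equivalence.  Transitivity is a constructor of
-- Permutation; the other laws need the nested recursion spelled out.

≈-refl  : ∀ {c} → c ≈ c
≋-refl  : ∀ {cs} → Pointwise _≈_ cs cs

≈-refl {⟨ αs ∣ βs ⟩} = ⟨ refl ≋-refl ∣ refl ≋-refl ⟩

≋-refl {[]}     = []
≋-refl {c ∷ cs} = ≈-refl ∷ ≋-refl

≈-sym : ∀ {c d} → c ≈ d → d ≈ c
≋-sym : ∀ {cs ds} → Pointwise _≈_ cs ds → Pointwise _≈_ ds cs
↭-sym : ∀ {cs ds} → Permutation _≈_ cs ds → Permutation _≈_ ds cs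

≈-sym ⟨ p ∣ q ⟩ = ⟨ ↭-sym p ∣ ↭-sym q ⟩

≋-sym []       = []
≋-sym (e ∷ es) = ≈-sym e ∷ ≋-sym es

↭-sym (refl es)    = refl (≋-sym es)
↭-sym (prep e p)   = prep (≈-sym e) (↭-sym p)
↭-sym (swap e f p) = swap (≈-sym f) (≈-sym e) (↭-sym p)
↭-sym (trans p q)  = trans (↭-sym q) (↭-sym p)

≈-trans : ∀ {c d e} → c ≈ d → d ≈ e → c ≈ e
≈-trans ⟨ p ∣ q ⟩ ⟨ p′ ∣ q′ ⟩ = ⟨ trans p p′ ∣ trans q q′ ⟩

≈-isEquivalence : IsEquivalence _≈_
≈-isEquivalence = record { refl = ≈-refl ; sym = ≈-sym ; trans = ≈-trans }

≈-setoid : Setoid 0ℓ 0ℓ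
≈-setoid = record { isEquivalence = ≈-isEquivalence }

open import Data.List.Relation.Binary.Permutation.Setoid ≈-setoid using (_↭_; ↭-refl)
open import Data.List.Relation.Binary.Permutation.Setoid.Properties ≈-setoid
  using (∈-resp-↭; drop-∷; xs↭ys⇒|xs|≡|ys|)

─-↭ : ∀ {c ds} (p : Any (c ≈_) ds) → (c ∷ (ds ─ p)) ↭ ds
─-↭ (here e)            = prep e ↭-refl
─-↭ {ds = d ∷ _} (there p) = trans (swap ≈-refl ≈-refl ↭-refl) (prep ≈-refl (─-↭ p))

_≟_  : Decidable _≈_
_↭?_ : Decidable _↭_

⟨ αs ∣ βs ⟩ ≟ ⟨ αs′ ∣ βs′ ⟩ =
  map′ (λ (p , q) → ⟨ p ∣ q ⟩) (λ { ⟨ p ∣ q ⟩ → p , q }) ((αs ↭? αs′) ×-dec (βs ↭? βs′))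

[]       ↭? []       = yes ↭-refl
[]       ↭? (d ∷ ds) = no λ p → contradiction (xs↭ys⇒|xs|≡|ys| p) λ ()
(c ∷ cs) ↭? ds with any? (λ d → c ≟ d) ds
... | no c∉ds = no λ p → c∉ds (∈-resp-↭ p (here ≈-refl))
... | yes c∈ds with cs ↭? (ds ─ c∈ds)
...   | yes p = yes (trans (prep ≈-refl p) (─-↭ c∈ds))
...   | no ¬p = no λ p → ¬p (drop-∷ (trans p (↭-sym (─-↭ c∈ds))))

Circuit : ℕ → Set
Circuit n = Σ[ c ∈ Rep ] IsCircuit c × size c ≡ n

circuits : ℕ → DecSetoid 0ℓ 0ℓ
circuits n = record
  { Carrier          = Circuit n
  ; _≈_              = _≈_ on proj₁
  ; isDecEquivalence = record
    { isEquivalence = On.isEquivalence proj₁ ≈-isEquivalence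
    ; _≟_           = On.decidable proj₁ _≈_ _≟_
    }
  }

module Circuits (n : ℕ) = DecSetoid (circuits n)

isSeries?    : ∀ c → Dec (IsSeries c)
isParallel?  : ∀ c → Dec (IsParallel c)
allSeries?   : ∀ cs → Dec (All IsSeries cs)
allParallel? : ∀ cs → Dec (All IsParallel cs)

isSeries? unit                   = yes unitˢ
isSeries? ⟨ _ ∷ [] ∣ [] ⟩        = no λ { (series (s≤s ()) _) }
isSeries? ⟨ α ∷ α′ ∷ αs ∣ [] ⟩   =
  map′ (series (s≤s (s≤s z≤n))) (λ { (series _ ps) → ps }) (allParallel? (α ∷ α′ ∷ αs))
isSeries? ⟨ _ ∣ _ ∷ _ ⟩          = no λ ()

isParallel? unit                 = yes unitᵖ
isParallel? ⟨ [] ∣ _ ∷ [] ⟩      = no λ { (parallel (s≤s ()) _) }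
isParallel? ⟨ [] ∣ β ∷ β′ ∷ βs ⟩ =
  map′ (parallel (s≤s (s≤s z≤n))) (λ { (parallel _ ps) → ps }) (allSeries? (β ∷ β′ ∷ βs))
isParallel? ⟨ _ ∷ _ ∣ _ ⟩        = no λ ()

allSeries? []       = yes []
allSeries? (c ∷ cs) = map′ (λ (p , ps) → p ∷ ps) (λ { (p ∷ ps) → p , ps }) (isSeries? c ×-dec allSeries? cs)

allParallel? []       = yes []
allParallel? (c ∷ cs) = map′ (λ (p , ps) → p ∷ ps) (λ { (p ∷ ps) → p , ps }) (isParallel? c ×-dec allParallel? cs)

isNCircuit? : ∀ n c → Dec (IsCircuit c × size c ≡ n)
isNCircuit? n c = (isSeries? c ⊎-dec isParallel? c) ×-dec (size c ℕ.≟ n)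

-- Γ n is obtained by listing all representations of nesting depth < n with
-- components of length ≤ n, keeping the n-circuits, and removing repetitions
-- up to _≈_.  Γ-enumerates and Γ-unique characterise the result: every
-- n-circuit occurs in Γ n exactly once up to _≈_.

lists : {A : Set} → ℕ → List A → List (List A)
lists zero    xs = [] ∷ []
lists (suc k) xs = [] ∷ cartesianProductWith _∷_ xs (lists k xs)

reps : (n d : ℕ) → List Rep
reps n zero    = []
reps n (suc d) = map (λ αs → ⟨ αs ∣ [] ⟩) (lists n (reps n d)) ++ map (λ βs → ⟨ [] ∣ βs ⟩) (lists n (reps n d))

toCircuit : ∀ n → Rep → Maybe (Circuit n)
toCircuit n c with isNCircuit? n c
... | yes p = just (c , p)
... | no  _ = nothing

candidates : ∀ n → List (Circuit n)
candidates n = mapMaybe (toCircuit n) (reps n n)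

Γ : ∀ n → List (Circuit n)
Γ n = deduplicate (Circuits._≟_ n) (candidates n)

∈-lists : {A : Set} {xs ys : List A} {k : ℕ} → length ys ≤ k → All (_∈ xs) ys → ys ∈ lists k xs
∈-lists {k = zero}  z≤n     []       = here ≡-refl
∈-lists {k = suc k} z≤n     []       = here ≡-refl
∈-lists             (s≤s l) (p ∷ ps) = there (∈-cartesianProductWith⁺ _∷_ p (∈-lists l ps))

size-pos  : ∀ c → 1 ≤ size c
size-pos unit               = s≤s z≤n
size-pos ⟨ α ∷ αs ∣ βs ⟩    =
  ℕ.≤-trans (size-pos α) (ℕ.≤-trans (ℕ.m≤m+n _ (sizes αs)) (ℕ.m≤m+n _ (sizes βs)))
size-pos ⟨ [] ∣ β ∷ βs ⟩    = ℕ.≤-trans (size-pos β) (ℕ.m≤m+n _ (sizes βs))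

length≤sizes : ∀ cs → length cs ≤ sizes cs
length≤sizes []       = z≤n
length≤sizes (c ∷ cs) = ℕ.+-mono-≤ (size-pos c) (length≤sizes cs)

size+length≤ : ∀ {c cs} → c ∈ cs → size c ℕ.+ length cs ≤ suc (sizes cs)
size+length≤ {c} {_ ∷ cs} (here ≡-refl) = begin
  size c ℕ.+ suc (length cs) ≡⟨ ℕ.+-suc (size c) _ ⟩
  suc (size c ℕ.+ length cs) ≤⟨ s≤s (ℕ.+-monoʳ-≤ (size c) (length≤sizes cs)) ⟩
  suc (size c ℕ.+ sizes cs)  ∎
  where open ℕ.≤-Reasoning
size+length≤ {c} {d ∷ cs} (there p) = begin
  size c ℕ.+ suc (length cs) ≡⟨ ℕ.+-suc (size c) _ ⟩
  suc (size c ℕ.+ length cs) ≤⟨ ℕ.+-mono-≤ (size-pos d) (size+length≤ p) ⟩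
  size d ℕ.+ suc (sizes cs)  ≡⟨ ℕ.+-suc (size d) _ ⟩
  suc (size d ℕ.+ sizes cs)  ∎
  where open ℕ.≤-Reasoning

size<sizes : ∀ {c cs} → 2 ≤ length cs → c ∈ cs → suc (size c) ≤ sizes cs
size<sizes {c} {cs} l p = ℕ.≤-pred (begin
  suc (suc (size c))      ≡⟨ ℕ.+-comm 2 (size c) ⟩
  size c ℕ.+ 2            ≤⟨ ℕ.+-monoʳ-≤ (size c) l ⟩
  size c ℕ.+ length cs    ≤⟨ size+length≤ p ⟩
  suc (sizes cs)          ∎)
  where open ℕ.≤-Reasoning

size-series : ∀ αs → 2 ≤ length αs → size ⟨ αs ∣ [] ⟩ ≡ sizes αs
size-series (_ ∷ _) _ = ℕ.+-identityʳ _

size-parallel : ∀ βs → 2 ≤ length βs → size ⟨ [] ∣ βs ⟩ ≡ sizes βs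
size-parallel (_ ∷ _) _ = ≡-refl

∈-reps : ∀ n d {c} → IsCircuit c → size c ≤ n → size c ≤ d → c ∈ reps n d
components : ∀ n d {cs} → All IsCircuit cs → 2 ≤ length cs →
             sizes cs ≤ n → sizes cs ≤ suc d → cs ∈ lists n (reps n d)

components n d {cs} ps l cs≤n cs≤d =
  ∈-lists (ℕ.≤-trans (length≤sizes cs) cs≤n) (All.tabulate λ c∈cs →
    ∈-reps n d (All.lookup ps c∈cs)
      (ℕ.≤-trans (ℕ.<⇒≤ (size<sizes l c∈cs)) cs≤n)
      (ℕ.≤-pred (ℕ.≤-trans (size<sizes l c∈cs) cs≤d)))

∈-reps n zero    {c} _ _ c≤0 = contradiction (ℕ.≤-trans (size-pos c) c≤0) λ ()
∈-reps n (suc d) (inj₁ unitˢ) _ _ =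
  ∈-++⁺ˡ (∈-map⁺ (λ αs → ⟨ αs ∣ [] ⟩) (∈-lists {xs = reps n d} {k = n} z≤n []))
∈-reps n (suc d) (inj₂ unitᵖ) _ _ =
  ∈-++⁺ˡ (∈-map⁺ (λ αs → ⟨ αs ∣ [] ⟩) (∈-lists {xs = reps n d} {k = n} z≤n []))
∈-reps n (suc d) (inj₁ (series {αs} l ps)) c≤n c≤d =
  ∈-++⁺ˡ (∈-map⁺ (λ αs → ⟨ αs ∣ [] ⟩) (components n d (All.map inj₂ ps) l
    (subst (_≤ n) (size-series αs l) c≤n) (subst (_≤ suc d) (size-series αs l) c≤d)))
∈-reps n (suc d) (inj₂ (parallel {βs} l ps)) c≤n c≤d =
  ∈-++⁺ʳ (map (λ αs → ⟨ αs ∣ [] ⟩) (lists n (reps n d)))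
    (∈-map⁺ (λ βs → ⟨ [] ∣ βs ⟩) (components n d (All.map inj₁ ps) l
      (subst (_≤ n) (size-parallel βs l) c≤n) (subst (_≤ suc d) (size-parallel βs l) c≤d)))

∈-mapMaybe : ∀ {n cs} (c : Circuit n) → proj₁ c ∈ cs → Any (Circuits._≈_ n c) (mapMaybe (toCircuit n) cs)
∈-mapMaybe {n} {d ∷ _} (_ , p) (here ≡-refl) with isNCircuit? n d
... | yes _ = here ≈-refl
... | no ¬p = contradiction p ¬p
∈-mapMaybe {n} {d ∷ _} c (there c∈cs) with isNCircuit? n d
... | yes _ = there (∈-mapMaybe c c∈cs)
... | no _  = ∈-mapMaybe c c∈cs

Γ-enumerates : ∀ n → IsEnumeration (Circuits.setoid n) (Γ n)
Γ-enumerates n = Enumerates.deduplicate⁺ (circuits n) λ c@(_ , p , c≡n) →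
  ∈-mapMaybe c (∈-reps n n p (ℕ.≤-reflexive c≡n) (ℕ.≤-reflexive c≡n))

Γ-unique : ∀ n → Unique (Circuits.setoid n) (Γ n)
Γ-unique n = Unique.deduplicate-! (circuits n) (candidates n)

Q : ℕ → ℕ
Q n = length (Γ n)

R : ℕ → ℚ
R n = foldr _+_ 0ℚ (map (r ∘ proj₁) (Γ n))

someCircuit : ∀ n → .{{ℕ.NonZero n}} → Circuit n
someCircuit 1               = unit , inj₁ unitˢ , ≡-refl
someCircuit n@(suc (suc m)) =
  ⟨ replicate n unit ∣ [] ⟩ ,
  inj₁ (series (s≤s (s≤s z≤n)) (All.replicate⁺ n unitᵖ)) ,
  cong (2 ℕ.+_) (Eq.trans (ℕ.+-identityʳ _) (sizes-units m))
  where
  import Relation.Binary.PropositionalEquality as Eq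
  sizes-units : ∀ k → sizes (replicate k unit) ≡ k
  sizes-units zero    = ≡-refl
  sizes-units (suc k) = cong suc (sizes-units k)

instance
  Q-nonZero : ∀ {n} → .{{ℕ.NonZero n}} → ℕ.NonZero (Q n)
  Q-nonZero {n} = nonEmpty {someCircuit n} (Γ-enumerates n (someCircuit n))
    where
    nonEmpty : ∀ {c : Circuit n} {cs} → Any (Circuits._≈_ n c) cs → ℕ.NonZero (length cs)
    nonEmpty (here _)  = _
    nonEmpty (there _) = _

M : ∀ n → .{{ℕ.NonZero n}} → ℚ
M n = R n * (+ 1 / Q n)

{-# OPTIONS --safe #-}

-- Exchanging series and parallel composition throughout a circuit is an
-- involution c ↦ c* on the n-circuits with r(c*) = 1/r(c).  Since it is
-- injective and resistances are positive, Σ r(c)⁻¹ = Σ r(c*) ≤ Rₙ, hence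
-- 2 Rₙ ≥ Σ (r(c) + r(c)⁻¹) ≥ 2 Qₙ.

module Submission where

open import Defs
open import Algebra.Bundles using (CommutativeMonoid; CommutativeSemigroup)
open import Data.Integer as ℤ using (+_)
import Data.Integer.Properties as ℤ
open import Data.List using (List; []; _∷_; foldr; length; map)
open import Data.List.Properties using (length-map)
import Data.List.Membership.Setoid as Membership
open import Data.List.Relation.Binary.Permutation.Homogeneous using (Permutation; refl; prep; swap; trans)
open import Data.List.Relation.Binary.Permutation.Setoid.Properties ≈-setoid
  using (∈-resp-↭; xs↭ys⇒|xs|≡|ys|)
open import Data.List.Relation.Binary.Pointwise using (Pointwise; []; _∷_)
import Data.List.Relation.Binary.Subset.Setoid as Subset
open import Data.List.Relation.Unary.All as All using (All; []; _∷_)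
import Data.List.Relation.Unary.All.Properties as All
open import Data.List.Relation.Unary.AllPairs using ([]; _∷_)
open import Data.List.Relation.Unary.Any as Any using (here; there; _─_)
import Data.List.Relation.Unary.Any.Properties as Any
open import Data.List.Relation.Unary.Unique.Setoid using (Unique)
import Data.List.Relation.Unary.Unique.Setoid.Properties as Unique
open import Data.Nat as ℕ using (ℕ; NonZero; suc)
import Data.Nat.Properties as ℕ
open import Data.Product using (_,_; proj₁)
open import Data.Rational
  using (ℚ; 0ℚ; 1ℚ; 1/_; _+_; _*_; _-_; _/_; _≤_; _≥_; Positive; NonNegative; nonNegative; nonPositive; toℚᵘ)
import Data.Rational as ℚ
open import Data.Rational.Properties
open import Data.Rational.Solver using (module +-*-Solver)
import Data.Rational.Unnormalised as ℚᵘ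
import Data.Rational.Unnormalised.Properties as ℚᵘ
open import Data.Sum using (inj₁; inj₂)
open import Function using (_∘_)
open import Relation.Binary.PropositionalEquality
  using (_≡_; cong; cong₂; sym; subst) renaming (refl to ≡-refl; trans to ≡-trans)
open import Relation.Nullary using (contradiction)

open Membership ≈-setoid using (_∈_)
open Subset ≈-setoid using (_⊆_)

-- Invariance of resistance under `_≈_`.

1/⁺ : ∀ p → Positive p → ℚ
1/⁺ p p>0 = 1/_ p {{pos⇒nonZero p {{p>0}}}}

-- `1/_` takes its nonzero evidence as an irrelevant argument, so the two positivity proofs may
-- differ.
1/⁺-cong : ∀ {p q} (p>0 : Positive p) (q>0 : Positive q) → p ≡ q → 1/⁺ p p>0 ≡ 1/⁺ q q>0
1/⁺-cong _ _ ≡-refl = ≡-refl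

1/⁺-involutive : ∀ p (p>0 : Positive p) (1/p>0 : Positive (1/⁺ p p>0)) → 1/⁺ (1/⁺ p p>0) 1/p>0 ≡ p
1/⁺-involutive p p>0 _ = 1/-involutive p {{pos⇒nonZero p {{p>0}}}}

+-swap : ∀ {p p′ q q′ s s′} → p ≡ p′ → q ≡ q′ → s ≡ s′ → p + (q + s) ≡ q′ + (p′ + s′)
+-swap {p} {q = q} {s = s} ≡-refl ≡-refl ≡-refl =
  solve 3 (λ p q s → p :+ (q :+ s) := q :+ (p :+ s)) ≡-refl p q s
  where open +-*-Solver

-- Mutual induction on the derivation of `_≈_`, with commutativity of addition for `swap`. `Σr-↭`
-- later allows one entry of a list to be traded for an equivalent representation that was found
-- elsewhere in another list.
r-cong    : ∀ {c d} → c ≈ d → r c ≡ r d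
r⁻¹-cong  : ∀ {c d} → c ≈ d → r⁻¹ c ≡ r⁻¹ d
Σr-≋      : ∀ {cs ds} → Pointwise _≈_ cs ds → Σr cs ≡ Σr ds
Σr-↭      : ∀ {cs ds} → Permutation _≈_ cs ds → Σr cs ≡ Σr ds
Σr⁻¹-≋    : ∀ {cs ds} → Pointwise _≈_ cs ds → Σr⁻¹ cs ≡ Σr⁻¹ ds
Σr⁻¹-↭    : ∀ {cs ds} → Permutation _≈_ cs ds → Σr⁻¹ cs ≡ Σr⁻¹ ds

r-cong {⟨ [] ∣ [] ⟩}         {⟨ [] ∣ [] ⟩}          _         = ≡-refl
r-cong {⟨ _ ∷ _ ∣ [] ⟩}      {⟨ _ ∷ _ ∣ [] ⟩}       ⟨ p ∣ _ ⟩ = Σr-↭ p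
r-cong {⟨ [] ∣ β ∷ βs ⟩}     {⟨ [] ∣ β′ ∷ βs′ ⟩}    ⟨ _ ∣ q ⟩ =
  1/⁺-cong (Σr⁻¹-pos β βs) (Σr⁻¹-pos β′ βs′) (Σr⁻¹-↭ q)
r-cong {⟨ _ ∷ _ ∣ _ ∷ _ ⟩}   {⟨ _ ∷ _ ∣ _ ∷ _ ⟩}    _         = ≡-refl
-- Permutations preserve length, so an empty component cannot face a nonempty one.
r-cong {⟨ [] ∣ _ ⟩}          {⟨ _ ∷ _ ∣ _ ⟩}        ⟨ p ∣ _ ⟩ = contradiction (xs↭ys⇒|xs|≡|ys| p) λ ()
r-cong {⟨ _ ∷ _ ∣ _ ⟩}       {⟨ [] ∣ _ ⟩}           ⟨ p ∣ _ ⟩ = contradiction (xs↭ys⇒|xs|≡|ys| p) λ ()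
r-cong {⟨ _ ∣ [] ⟩}          {⟨ _ ∣ _ ∷ _ ⟩}        ⟨ _ ∣ q ⟩ = contradiction (xs↭ys⇒|xs|≡|ys| q) λ ()
r-cong {⟨ _ ∣ _ ∷ _ ⟩}       {⟨ _ ∣ [] ⟩}           ⟨ _ ∣ q ⟩ = contradiction (xs↭ys⇒|xs|≡|ys| q) λ ()

r⁻¹-cong {c} {d} c≈d = 1/⁺-cong (r-pos c) (r-pos d) (r-cong c≈d)

Σr-≋ []       = ≡-refl
Σr-≋ (e ∷ es) = cong₂ _+_ (r-cong e) (Σr-≋ es)

Σr-↭ (refl es)    = Σr-≋ es
Σr-↭ (prep e p)   = cong₂ _+_ (r-cong e) (Σr-↭ p)
Σr-↭ (swap e f p) = +-swap (r-cong e) (r-cong f) (Σr-↭ p)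
Σr-↭ (trans p q)  = ≡-trans (Σr-↭ p) (Σr-↭ q)

Σr⁻¹-≋ []       = ≡-refl
Σr⁻¹-≋ (e ∷ es) = cong₂ _+_ (r⁻¹-cong e) (Σr⁻¹-≋ es)

Σr⁻¹-↭ (refl es)    = Σr⁻¹-≋ es
Σr⁻¹-↭ (prep e p)   = cong₂ _+_ (r⁻¹-cong e) (Σr⁻¹-↭ p)
Σr⁻¹-↭ (swap e f p) = +-swap (r⁻¹-cong e) (r⁻¹-cong f) (Σr⁻¹-↭ p)
Σr⁻¹-↭ (trans p q)  = ≡-trans (Σr⁻¹-↭ p) (Σr⁻¹-↭ q)

-- The series-parallel dual.

dual  : Rep → Rep
duals : List Rep → List Rep

dual ⟨ αs ∣ βs ⟩ = ⟨ duals βs ∣ duals αs ⟩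

duals []       = []
duals (c ∷ cs) = dual c ∷ duals cs

-- `duals` keeps the recursion of `dual` structural; the `map` form makes the library lemmas on
-- length, membership and uniqueness available.
duals≡map : ∀ cs → duals cs ≡ map dual cs
duals≡map []       = ≡-refl
duals≡map (c ∷ cs) = cong (dual c ∷_) (duals≡map cs)

length-duals : ∀ cs → length (duals cs) ≡ length cs
length-duals cs = ≡-trans (cong length (duals≡map cs)) (length-map dual cs)

dual-involutive  : ∀ c → dual (dual c) ≡ c
duals-involutive : ∀ cs → duals (duals cs) ≡ cs

dual-involutive ⟨ αs ∣ βs ⟩ = cong₂ ⟨_∣_⟩ (duals-involutive αs) (duals-involutive βs)

duals-involutive []       = ≡-refl
duals-involutive (c ∷ cs) = cong₂ _∷_ (dual-involutive c) (duals-involutive cs)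

dual-cong : ∀ {c d} → c ≈ d → dual c ≈ dual d
duals-≋   : ∀ {cs ds} → Pointwise _≈_ cs ds → Pointwise _≈_ (duals cs) (duals ds)
duals-↭   : ∀ {cs ds} → Permutation _≈_ cs ds → Permutation _≈_ (duals cs) (duals ds)

dual-cong ⟨ p ∣ q ⟩ = ⟨ duals-↭ q ∣ duals-↭ p ⟩

duals-≋ []       = []
duals-≋ (e ∷ es) = dual-cong e ∷ duals-≋ es

duals-↭ (refl es)    = refl (duals-≋ es)
duals-↭ (prep e p)   = prep (dual-cong e) (duals-↭ p)
duals-↭ (swap e f p) = swap (dual-cong e) (dual-cong f) (duals-↭ p)
duals-↭ (trans p q)  = trans (duals-↭ p) (duals-↭ q)

dual-injective : ∀ {c d} → dual c ≈ dual d → c ≈ d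
dual-injective {c} {d} e
  -- The goal becomes `dual (dual c) ≈ dual (dual d)`. This also turns the duals in `e` into triple
  -- duals, which the second pair of rewrites contracts again.
  rewrite sym (dual-involutive c) | sym (dual-involutive d)
        | dual-involutive (dual c) | dual-involutive (dual d) = dual-cong e

dual-series   : ∀ {c} → IsSeries c → IsParallel (dual c)
dual-parallel : ∀ {c} → IsParallel c → IsSeries (dual c)
duals-series   : ∀ {cs} → All IsSeries cs → All IsParallel (duals cs)
duals-parallel : ∀ {cs} → All IsParallel cs → All IsSeries (duals cs)

dual-series unitˢ             = unitᵖ
dual-series (series {αs} l ps) = parallel (subst (2 ℕ.≤_) (sym (length-duals αs)) l) (duals-parallel ps)

dual-parallel unitᵖ               = unitˢ
dual-parallel (parallel {βs} l ps) = series (subst (2 ℕ.≤_) (sym (length-duals βs)) l) (duals-series ps)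

duals-series []       = []
duals-series (p ∷ ps) = dual-series p ∷ duals-series ps

duals-parallel []       = []
duals-parallel (p ∷ ps) = dual-parallel p ∷ duals-parallel ps

dual-circuit : ∀ {c} → IsCircuit c → IsCircuit (dual c)
dual-circuit (inj₁ s) = inj₂ (dual-series s)
dual-circuit (inj₂ p) = inj₁ (dual-parallel p)

size-dual   : ∀ c → size (dual c) ≡ size c
sizes-duals : ∀ cs → sizes (duals cs) ≡ sizes cs

size-dual ⟨ [] ∣ [] ⟩         = ≡-refl
size-dual ⟨ [] ∣ β ∷ βs ⟩     = ≡-trans (ℕ.+-identityʳ _) (sizes-duals (β ∷ βs))
size-dual ⟨ α ∷ αs ∣ [] ⟩     = ≡-trans (sizes-duals (α ∷ αs)) (sym (ℕ.+-identityʳ _))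
size-dual ⟨ α ∷ αs ∣ β ∷ βs ⟩ =
  ≡-trans (cong₂ ℕ._+_ (sizes-duals (β ∷ βs)) (sizes-duals (α ∷ αs))) (ℕ.+-comm (sizes (β ∷ βs)) _)

sizes-duals []       = ≡-refl
sizes-duals (c ∷ cs) = cong₂ ℕ._+_ (size-dual c) (sizes-duals cs)

dualᶜ : ∀ {n} → Circuit n → Circuit n
dualᶜ (c , p , c≡n) = dual c , dual-circuit p , ≡-trans (size-dual c) c≡n

-- Series composition adds resistances and parallel composition adds reciprocals, so inverting one
-- rule yields the other. It holds for every `Rep`, since the dummy value 1 is its own reciprocal.
r-dual     : ∀ c → r (dual c) ≡ r⁻¹ c
r⁻¹-dual   : ∀ c → r⁻¹ (dual c) ≡ r c
Σr-duals   : ∀ cs → Σr (duals cs) ≡ Σr⁻¹ cs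
Σr⁻¹-duals : ∀ cs → Σr⁻¹ (duals cs) ≡ Σr cs

r-dual ⟨ [] ∣ [] ⟩           = ≡-refl
r-dual ⟨ [] ∣ β ∷ βs ⟩       = ≡-trans (Σr-duals (β ∷ βs))
  (sym (1/⁺-involutive (Σr⁻¹ (β ∷ βs)) (Σr⁻¹-pos β βs) (r-pos ⟨ [] ∣ β ∷ βs ⟩)))
r-dual ⟨ α ∷ αs ∣ [] ⟩       =
  1/⁺-cong (Σr⁻¹-pos (dual α) (duals αs)) (Σr-pos α αs) (Σr⁻¹-duals (α ∷ αs))
r-dual ⟨ _ ∷ _ ∣ _ ∷ _ ⟩     = ≡-refl

r⁻¹-dual c = ≡-trans
  (1/⁺-cong (r-pos (dual c)) (r⁻¹-pos c) (r-dual c))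
  (1/⁺-involutive (r c) (r-pos c) (r⁻¹-pos c))

Σr-duals []       = ≡-refl
Σr-duals (c ∷ cs) = cong₂ _+_ (r-dual c) (Σr-duals cs)

Σr⁻¹-duals []       = ≡-refl
Σr⁻¹-duals (c ∷ cs) = cong₂ _+_ (r⁻¹-dual c) (Σr⁻¹-duals cs)

-- Comparison of sums under inclusion.

Σr-nonNeg : ∀ cs → 0ℚ ≤ Σr cs
Σr-nonNeg []       = ≤-refl
Σr-nonNeg (c ∷ cs) = <⇒≤ (positive⁻¹ (Σr (c ∷ cs)) {{Σr-pos c cs}})

-- Each entry of `cs` is matched with one of `ds`, which is then removed. As `cs` has no
-- repetitions, the remaining entries still find their matches, and whatever is left of `ds`
-- contributes a nonnegative sum.
Σr-mono-⊆ : ∀ {cs ds} → Unique ≈-setoid cs → cs ⊆ ds → Σr cs ≤ Σr ds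
Σr-mono-⊆ {[]}     {ds} _           _     = Σr-nonNeg ds
Σr-mono-⊆ {c ∷ cs} {ds} (c∉cs ∷ cs!) cs⊆ds = begin
  r c + Σr cs          ≤⟨ +-monoʳ-≤ (r c) (Σr-mono-⊆ cs! cs⊆ds─c) ⟩
  r c + Σr (ds ─ c∈ds) ≡⟨ Σr-↭ (─-↭ c∈ds) ⟩
  Σr ds                ∎
  where
  open ≤-Reasoning
  c∈ds : c ∈ ds
  c∈ds = cs⊆ds (here ≈-refl)
  cs⊆ds─c : cs ⊆ (ds ─ c∈ds)
  cs⊆ds─c d∈cs with ∈-resp-↭ (↭-sym (─-↭ c∈ds)) (cs⊆ds (there d∈cs))
  ... | there d∈ = d∈
  -- A later entry of `cs` whose match is the removed one would be equivalent to `c`, which `c∉cs`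
  -- excludes.
  ... | here d≈c = contradiction d∈cs (All.All¬⇒¬Any (All.map (λ c≉e d≈e → c≉e (≈-trans (≈-sym d≈c) d≈e)) c∉cs))

-- A number plus its reciprocal, and sums of such pairs.

-- When pq = 1, the nonnegative number (p - 1)²q expands to p - 2 + q. The expansion is grouped so
-- that p occurs next to q only as `p * q`, ready for substitution.
p*q≡1⇒p+q≥2 : ∀ p q .{{_ : Positive q}} → p * q ≡ 1ℚ → 1ℚ + 1ℚ ≤ p + q
p*q≡1⇒p+q≥2 p q p*q≡1 = begin
  1ℚ + 1ℚ                                           ≡⟨ +-identityʳ _ ⟨
  1ℚ + 1ℚ + 0ℚ                                      ≤⟨ +-monoʳ-≤ (1ℚ + 1ℚ) remainder≥0 ⟩
  1ℚ + 1ℚ + (p - 1ℚ) * (p - 1ℚ) * q                 ≡⟨ expand p q ⟩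
  1ℚ + 1ℚ + (p * (p * q) - p * q - p * q + q)       ≡⟨ cong (λ s → 1ℚ + 1ℚ + (p * s - s - s + q)) p*q≡1 ⟩
  1ℚ + 1ℚ + (p * 1ℚ - 1ℚ - 1ℚ + q)                  ≡⟨ collect p q ⟩
  p + q                                             ∎
  where
  open ≤-Reasoning
  open +-*-Solver
  expand : ∀ p q → 1ℚ + 1ℚ + (p - 1ℚ) * (p - 1ℚ) * q ≡ 1ℚ + 1ℚ + (p * (p * q) - p * q - p * q + q)
  expand = solve 2 (λ p q → con 1ℚ :+ con 1ℚ :+ (p :- con 1ℚ) :* (p :- con 1ℚ) :* q
    := con 1ℚ :+ con 1ℚ :+ (p :* (p :* q) :- p :* q :- p :* q :+ q)) ≡-refl
  collect : ∀ p q → 1ℚ + 1ℚ + (p * 1ℚ - 1ℚ - 1ℚ + q) ≡ p + q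
  collect = solve 2 (λ p q → con 1ℚ :+ con 1ℚ :+ (p :* con 1ℚ :- con 1ℚ :- con 1ℚ :+ q) := p :+ q) ≡-refl
  square : NonNegative ((p - 1ℚ) * (p - 1ℚ))
  square with ≤-total 1ℚ p
  ... | inj₁ 1≤p = nonNeg*nonNeg⇒nonNeg (p - 1ℚ) {{p-1≥0}} (p - 1ℚ) {{p-1≥0}}
    where p-1≥0 = nonNegative (+-monoˡ-≤ (ℚ.- 1ℚ) 1≤p)
  ... | inj₂ p≤1 = nonPos*nonPos⇒nonPos (p - 1ℚ) {{p-1≤0}} (p - 1ℚ) {{p-1≤0}}
    where p-1≤0 = nonPositive (+-monoˡ-≤ (ℚ.- 1ℚ) p≤1)
  remainder≥0 : 0ℚ ≤ (p - 1ℚ) * (p - 1ℚ) * q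
  remainder≥0 = nonNegative⁻¹ _
    {{nonNeg*nonNeg⇒nonNeg ((p - 1ℚ) * (p - 1ℚ)) {{square}} q {{pos⇒nonNeg q}}}}

-- `_/_` divides out a gcd that does not compute for a variable `k`, so the identity is checked on
-- unnormalised fractions.
suc/1 : ∀ k → + suc k / 1 ≡ 1ℚ + (+ k / 1)
suc/1 k = toℚᵘ-injective (begin
  toℚᵘ (+ suc k / 1)                ≈⟨ toℚᵘ-fromℚᵘ (ℚᵘ.mkℚᵘ (+ suc k) 0) ⟩
  ℚᵘ.mkℚᵘ (+ suc k) 0               ≈⟨ ℚᵘ.*≡* (cong (ℤ._* + 1) (cong (λ j → + 1 ℤ.+ j) (sym (ℤ.*-identityʳ (+ k))))) ⟩
  ℚᵘ.1ℚᵘ ℚᵘ.+ ℚᵘ.mkℚᵘ (+ k) 0        ≈⟨ ℚᵘ.+-congʳ ℚᵘ.1ℚᵘ (toℚᵘ-fromℚᵘ (ℚᵘ.mkℚᵘ (+ k) 0)) ⟨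
  ℚᵘ.1ℚᵘ ℚᵘ.+ toℚᵘ (+ k / 1)         ≈⟨ toℚᵘ-homo-+ 1ℚ (+ k / 1) ⟨
  toℚᵘ (1ℚ + (+ k / 1))             ∎)
  where open ℚᵘ.≃-Reasoning

n/1*1/n≡1 : ∀ n .{{_ : NonZero n}} → (+ n / 1) * (+ 1 / n) ≡ 1ℚ
n/1*1/n≡1 n@(suc k) = toℚᵘ-injective (begin
  toℚᵘ ((+ n / 1) * (+ 1 / n))               ≈⟨ toℚᵘ-homo-* (+ n / 1) (+ 1 / n) ⟩
  toℚᵘ (+ n / 1) ℚᵘ.* toℚᵘ (+ 1 / n)         ≈⟨ ℚᵘ.*-cong (toℚᵘ-fromℚᵘ (ℚᵘ.mkℚᵘ (+ n) 0)) (toℚᵘ-fromℚᵘ (ℚᵘ.mkℚᵘ (+ 1) k)) ⟩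
  ℚᵘ.mkℚᵘ (+ n) 0 ℚᵘ.* ℚᵘ.mkℚᵘ (+ 1) k       ≈⟨ ℚᵘ.*-inverseʳ (ℚᵘ.mkℚᵘ (+ n) 0) ⟩
  ℚᵘ.1ℚᵘ                                     ∎)
  where open ℚᵘ.≃-Reasoning

+-commutativeSemigroup : CommutativeSemigroup _ _
+-commutativeSemigroup = CommutativeMonoid.commutativeSemigroup +-0-commutativeMonoid

Σr+Σr⁻¹≥2length : ∀ cs → (+ length cs / 1) + (+ length cs / 1) ≤ Σr cs + Σr⁻¹ cs
Σr+Σr⁻¹≥2length []       = ≤-refl
Σr+Σr⁻¹≥2length (c ∷ cs) = begin
  (+ suc (length cs) / 1) + (+ suc (length cs) / 1)  ≡⟨ cong₂ _+_ (suc/1 (length cs)) (suc/1 (length cs)) ⟩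
  (1ℚ + l) + (1ℚ + l)                ≡⟨ interchange 1ℚ l 1ℚ l ⟩
  (1ℚ + 1ℚ) + (l + l)                ≤⟨ +-mono-≤ r+r⁻¹≥2 (Σr+Σr⁻¹≥2length cs) ⟩
  (r c + r⁻¹ c) + (Σr cs + Σr⁻¹ cs)  ≡⟨ interchange (r c) (r⁻¹ c) (Σr cs) (Σr⁻¹ cs) ⟩
  (r c + Σr cs) + (r⁻¹ c + Σr⁻¹ cs)  ∎
  where
  open ≤-Reasoning
  open import Algebra.Properties.CommutativeSemigroup +-commutativeSemigroup using (interchange)
  l = + length cs / 1
  r+r⁻¹≥2 : 1ℚ + 1ℚ ≤ r c + r⁻¹ c
  r+r⁻¹≥2 = p*q≡1⇒p+q≥2 (r c) (r⁻¹ c) {{r⁻¹-pos c}} (*-inverseʳ (r c) {{pos⇒nonZero (r c) {{r-pos c}}}})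

p+p≤q+q⇒p≤q : ∀ {p q} → p + p ≤ q + q → p ≤ q
p+p≤q+q⇒p≤q p+p≤q+q = ≮⇒≥ λ q<p → <-irrefl ≡-refl (<-≤-trans (+-mono-< q<p q<p) p+p≤q+q)

-- The sum over all n-circuits.

Γᴿ : ℕ → List Rep
Γᴿ n = map proj₁ (Γ n)

R≡Σr : ∀ n → R n ≡ Σr (Γᴿ n)
R≡Σr n = go (Γ n)
  where
  go : (cs : List (Circuit n)) → foldr _+_ 0ℚ (map (r ∘ proj₁) cs) ≡ Σr (map proj₁ cs)
  go []       = ≡-refl
  go (c ∷ cs) = cong (_+_ (r (proj₁ c))) (go cs)

Γᴿ-unique : ∀ n → Unique ≈-setoid (Γᴿ n)
-- Equivalence in `Circuit n` is by definition `_≈_` on first components, so the identity function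
-- proves `proj₁` injective.
Γᴿ-unique n = Unique.map⁺ (Circuits.setoid n) ≈-setoid (λ e → e) (Γ-unique n)

-- The dual of an n-circuit is again an n-circuit, and `Γ-enumerates` finds every n-circuit in `Γ n`
-- up to `_≈_`.
duals-Γ⊆Γ : ∀ n → duals (Γᴿ n) ⊆ Γᴿ n
duals-Γ⊆Γ n d∈ rewrite duals≡map (Γᴿ n)
  with Any.satisfied (Any.map⁻ {xs = Γ n} (Any.map⁻ {f = dual} d∈))
... | c , d≈c* = Any.map⁺ (Any.map (≈-trans d≈c*) (Γ-enumerates n (dualᶜ c)))

-- By `Σr-duals` the left side is the total resistance of the duals, which are pairwise inequivalent
-- because `dual` is injective.
Σr⁻¹Γ≤ΣrΓ : ∀ n → Σr⁻¹ (Γᴿ n) ≤ Σr (Γᴿ n)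
Σr⁻¹Γ≤ΣrΓ n = subst (_≤ Σr (Γᴿ n)) (Σr-duals (Γᴿ n)) (Σr-mono-⊆ duals! (duals-Γ⊆Γ n))
  where
  duals! : Unique ≈-setoid (duals (Γᴿ n))
  duals! rewrite duals≡map (Γᴿ n) = Unique.map⁺ ≈-setoid ≈-setoid dual-injective (Γᴿ-unique n)

Q≤R : ∀ n → + Q n / 1 ≤ R n
Q≤R n = p+p≤q+q⇒p≤q (begin
  (+ Q n / 1) + (+ Q n / 1)                        ≡⟨ cong (λ k → (+ k / 1) + (+ k / 1)) (length-map proj₁ (Γ n)) ⟨
  (+ length (Γᴿ n) / 1) + (+ length (Γᴿ n) / 1)    ≤⟨ Σr+Σr⁻¹≥2length (Γᴿ n) ⟩
  Σr (Γᴿ n) + Σr⁻¹ (Γᴿ n)                          ≤⟨ +-monoʳ-≤ (Σr (Γᴿ n)) (Σr⁻¹Γ≤ΣrΓ n) ⟩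
  Σr (Γᴿ n) + Σr (Γᴿ n)                            ≡⟨ cong₂ _+_ (R≡Σr n) (R≡Σr n) ⟨
  R n + R n                                        ∎)
  where open ≤-Reasoning

corollary2p1p1 : ∀ (n : ℕ) → .{{_ : NonZero n}} → M n ≥ 1ℚ
corollary2p1p1 n = begin
  1ℚ                         ≡⟨ n/1*1/n≡1 (Q n) ⟨
  -- `Q≤R` is scaled by the nonnegative `+ 1 / Q n`, which is defined thanks to the instance
  -- `Q-nonZero`; the result is `M n` unfolded.
  (+ Q n / 1) * (+ 1 / Q n)  ≤⟨ *-monoʳ-≤-nonNeg (+ 1 / Q n) {{normalize-nonNeg 1 (Q n)}} (Q≤R n) ⟩
  R n * (+ 1 / Q n)          ∎
  where open ≤-Reasoning
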